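{- The commutator subgroup of $Q$ is $Q_0$; that is, $Q^{\mathrm{ab}}=Q/Q_0$.
   Context: Let $p$ be a prime, $e\ge1$, $k^{ac}$ an algebraic closure of $\mathbb{F}_p$. $Q$ is the group of elements $g(a,b,c)$ with $a\in\mu_{p^e+1}(k^{ac})$, $b,c\in k^{ac}$, $b^{p^{2e}}+b=0$, $c^p-c+b^{p^e+1}=0$, with multiplication $g(a_1,b_1,c_1)g(a_2,b_2,c_2)=g(a_1a_2,b_1+a_1b_2,c_1+c_2+\sum_{i=0}^{e-1}(a_1b_1^{p^e}b_2)^{p^i})$, and $Q_0=\{g(1,b,c)\in Q\}$. -}

module Defs where

open import Level using (Level; _⊔_)
open import Algebra.Bundles using (CommutativeRing)
open import Data.Nat using (ℕ; zero; suc) renaming (_+_ to _+ℕ_; _^_ to _^ℕ_)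
open import Data.Nat.Primality using (Prime)
open import Data.List using (List; []; _∷_; length; map)
open import Data.Product using (Σ; ∃; _×_; _,_)
open import Relation.Nullary using (¬_)

-- Everything is relative to a commutative ring R (with setoid equality _≈_),
-- which the hypotheses below force to be an algebraic closure of 𝔽_p.
module _ {c ℓ : Level} (R : CommutativeRing c ℓ) where
  open CommutativeRing R

  -- natural-number powers x ^ n
  pow : Carrier → ℕ → Carrier
  pow x zero    = 1#
  pow x (suc n) = x * pow x n

  -- image of n : ℕ in R  (n · 1)
  fromℕ : ℕ → Carrier
  fromℕ zero    = 0#
  fromℕ (suc n) = 1# + fromℕ n

  -- evaluation of Σ_i cs_i x^i (coefficient list, constant term first)
  evalPoly : List Carrier → Carrier → Carrier
  evalPoly []       x = 0#
  evalPoly (a ∷ cs) x = a + x * evalPoly cs x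

  -- R is a field
  IsField : Set (c ⊔ ℓ)
  IsField = (¬ (1# ≈ 0#)) × (∀ x → ¬ (x ≈ 0#) → ∃ λ y → x * y ≈ 1#)

  -- every monic polynomial of degree ≥ 1 has a root
  AlgClosed : Set (c ⊔ ℓ)
  AlgClosed = ∀ (cs : List Carrier) → ∃ λ x → pow x (suc (length cs)) + evalPoly cs x ≈ 0#

  -- every element is algebraic over the prime field (root of a monic
  -- polynomial with coefficients in the image of ℕ)
  AlgebraicOverPrimeField : Set (c ⊔ ℓ)
  AlgebraicOverPrimeField =
    ∀ x → ∃ λ (ns : List ℕ) → pow x (suc (length ns)) + evalPoly (map fromℕ ns) x ≈ 0#

  -- R is an algebraic closure of 𝔽_p
  IsAlgClosureOfFp : ℕ → Set (c ⊔ ℓ)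
  IsAlgClosureOfFp p = Prime p × (fromℕ p ≈ 0#) × IsField × AlgClosed × AlgebraicOverPrimeField

  -- elements g(a,b,c) as triples
  record Triple : Set c where
    constructor g
    field
      a : Carrier
      b : Carrier
      cc : Carrier
  open Triple public

  _≈T_ : Triple → Triple → Set ℓ
  g a₁ b₁ c₁ ≈T g a₂ b₂ c₂ = (a₁ ≈ a₂) × (b₁ ≈ b₂) × (c₁ ≈ c₂)

  module _ (p e : ℕ) where
    -- membership in Q
    InQ : Triple → Set ℓ
    InQ (g a b c') =
      (pow a (p ^ℕ e +ℕ 1) ≈ 1#) ×
      (pow b (p ^ℕ (2 Data.Nat.* e)) + b ≈ 0#) ×
      (pow c' p - c' + pow b (p ^ℕ e +ℕ 1) ≈ 0#)

    -- Σ_{i=0}^{n-1} x^{p^i}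
    frobSum : ℕ → Carrier → Carrier
    frobSum zero    x = 0#
    frobSum (suc n) x = frobSum n x + pow x (p ^ℕ n)

    -- the group law
    _·_ : Triple → Triple → Triple
    g a₁ b₁ c₁ · g a₂ b₂ c₂ =
      g (a₁ * a₂) (b₁ + a₁ * b₂) (c₁ + c₂ + frobSum e (a₁ * pow b₁ (p ^ℕ e) * b₂))

    identityQ : Triple
    identityQ = g 1# 0# 0#

    -- z is a commutator of elements of Q:  z = x y x⁻¹ y⁻¹, i.e. x y = z (y x)
    IsCommutator : Triple → Set (c ⊔ ℓ)
    IsCommutator z = ∃ λ x → ∃ λ y → InQ x × InQ y × ((x · y) ≈T (z · (y · x)))

    -- the commutator subgroup [Q,Q]: finite products of commutators
    -- (inverses are not needed since [x,y]⁻¹ = [y,x])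
    data InCommutatorSubgroup : Triple → Set (c ⊔ ℓ) where
      unit : ∀ {h} → h ≈T identityQ → InCommutatorSubgroup h
      step : ∀ {h z w} → InCommutatorSubgroup h → InQ z → IsCommutator z →
             w ≈T (h · z) → InCommutatorSubgroup w

    -- Q₀ = { g(1,b,c) ∈ Q }
    InQ₀ : Triple → Set ℓ
    InQ₀ t = InQ t × (a t ≈ 1#)

module Submission where

open import Defs
open import Level using (Level)
open import Algebra.Bundles using (CommutativeRing)
open import Data.Nat using (ℕ; _≤_)
open import Data.Product using (_×_)
open import Data.Nat as ℕ using (zero; suc; _<_; s≤s; z≤n)
import Data.Nat.Properties as ℕP
open import Data.Nat.Primality using (Prime)
open import Data.Product using (_,_; ∃; proj₁; proj₂)
open import Relation.Binary.PropositionalEquality as ≡ using (_≡_)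

-- The commutator subgroup of Q is Q₀ = {g(1,b,c) ∈ Q}  (Q^ab = Q/Q₀).
--
-- [Q,Q] ⊆ Q₀: the coordinate a : Q → μ_(q+1) (q = p^e) is multiplicative with
-- values in a commutative group of units, so it is 1 on every commutator and
-- hence on every product of commutators.  This holds in any commutative ring.
--
-- Q₀ ⊆ [Q,Q] uses that R is an algebraically closed field of characteristic p.
-- For g(1,β,c) ∈ Q, commuting g(a₀,0,0) (a₀ ∈ μ_(q+1), a₀ ≠ 1) with a suitable
-- g(1,β/(a₀-1),·) yields g(1,β,γ); the quotient g(1,0,c-γ) is central with
-- c - γ ∈ 𝔽_p, and every such element is a commutator of two elements
-- g(1,b₁,·), g(1,b₂,·) whose Frobenius sums differ by a preimage of c - γ.

-- p divides the binomial coefficient (p choose k) for 0 < k < p: it divides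
-- p! = (p C k) · k! · (p-k)! but, by Euclid's lemma, neither k! nor (p-k)!.
module PrimeBinomial where
  open import Data.Nat using (_∸_; _*_; _!; NonZero; nonTrivial⇒n>1)
  open import Data.Nat.Properties using (<⇒≱; <⇒≤; <-trans; n<1+n; ∸-monoʳ-<; _!*_!≢0)
  open import Data.Nat.Divisibility using (_∣_; ∣⇒≤; m∣m*n)
  open import Data.Nat.Primality using (prime⇒nonTrivial; euclidsLemma)
  open import Data.Nat.DivMod using (m/n*n≡m)
  open import Data.Nat.Combinatorics using (_C_; nCk≡n!/k![n-k]!; k![n∸k]!∣n!)
  open import Data.Sum using (inj₁; inj₂)
  open import Relation.Nullary using (¬_)
  open import Data.Empty using (⊥-elim)
  open ≡ using (trans; cong; sym; subst)

  prime≥2 : ∀ {p} → Prime p → 2 ≤ p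
  prime≥2 {p} pr = nonTrivial⇒n>1 p {{prime⇒nonTrivial pr}}

  -- a prime does not divide m! for m < p
  prime∤factorial : ∀ {p} → Prime p → ∀ m → m < p → ¬ (p ∣ m !)
  prime∤factorial pr zero    m<p p∣1 = <⇒≱ (prime≥2 pr) (∣⇒≤ p∣1)
  prime∤factorial pr (suc m) m<p p∣m! with euclidsLemma (suc m) (m !) pr p∣m!
  ... | inj₁ p∣1+m = <⇒≱ m<p (∣⇒≤ p∣1+m)
  ... | inj₂ p∣m!  = prime∤factorial pr m (<-trans (n<1+n m) m<p) p∣m!

  prime∣binomial : ∀ {p} → Prime p → ∀ k → 0 < k → k < p → p ∣ (p C k)
  prime∣binomial {p} pr k 0<k k<p with euclidsLemma (p C k) (k ! * (p ∸ k) !) pr p∣product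
    where
    instance
      k![p-k]!≢0 : NonZero (k ! * (p ∸ k) !)
      k![p-k]!≢0 = k !* (p ∸ k) !≢0
    p!-factorised : (p C k) * (k ! * (p ∸ k) !) ≡ p !
    p!-factorised = trans (cong (_* (k ! * (p ∸ k) !)) (nCk≡n!/k![n-k]! (<⇒≤ k<p)))
                          (m/n*n≡m (k![n∸k]!∣n! (<⇒≤ k<p)))
    n∣n! : ∀ n → 1 ≤ n → n ∣ n !
    n∣n! (suc n) _ = m∣m*n (n !)
    p∣product : p ∣ (p C k) * (k ! * (p ∸ k) !)
    p∣product = subst (p ∣_) (sym p!-factorised) (n∣n! p (<-trans 0<k k<p))
  ... | inj₁ p∣C = p∣C
  ... | inj₂ p∣k![p-k]! with euclidsLemma (k !) ((p ∸ k) !) pr p∣k![p-k]!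
  ... | inj₁ p∣k!    = ⊥-elim (prime∤factorial pr k k<p p∣k!)
  ... | inj₂ p∣[p-k]! = ⊥-elim (prime∤factorial pr (p ∸ k) (∸-monoʳ-< 0<k (<⇒≤ k<p)) p∣[p-k]!)

-- The ring solver of the library, instantiated with integer coefficients:
-- this needs the canonical ring homomorphism ℤ → R, and lets the solver
-- cancel terms such as x - x, which a solver whose coefficients live in R
-- itself cannot decide.
module IntegerCoefficientSolver {c ℓ : Level} (R : CommutativeRing c ℓ) where
  open import Data.Integer as ℤ using (ℤ; +_; -[1+_]; _⊖_)
  import Data.Integer.Properties as ℤ
  open import Data.Maybe using (Maybe; just; nothing)
  open import Relation.Nullary using (yes; no)
  import Algebra.Solver.Ring.AlmostCommutativeRing as ACR
  open CommutativeRing R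
  open import Algebra.Properties.Ring ring using (-‿involutive; -‿distribˡ-*; -‿distribʳ-*; -0#≈0#; -‿+-comm)
  open import Algebra.Properties.Semiring.Mult.TCOptimised semiring using (×-homo-+; ×1-homo-*) renaming (_×_ to _×ᴿ_)
  open import Relation.Binary.Reasoning.Setoid setoid

  -- the image of an integer in R; n ×ᴿ 1# reduces to 1# for n = 1, so the
  -- solver's constant 1 is literally 1#
  fromℤ : ℤ → Carrier
  fromℤ (+ n)    = n ×ᴿ 1#
  fromℤ -[1+ n ] = - (suc n ×ᴿ 1#)

  fromℤ-⊖ : ∀ m n → fromℤ (m ⊖ n) ≈ m ×ᴿ 1# - n ×ᴿ 1#
  fromℤ-⊖ m       zero    = sym (trans (+-congˡ -0#≈0#) (+-identityʳ _))
  fromℤ-⊖ zero    (suc n) = sym (+-identityˡ _)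
  fromℤ-⊖ (suc m) (suc n) = begin
    fromℤ (suc m ⊖ suc n)          ≡⟨ ≡.cong fromℤ (ℤ.[1+m]⊖[1+n]≡m⊖n m n) ⟩
    fromℤ (m ⊖ n)                  ≈⟨ fromℤ-⊖ m n ⟩
    m ×ᴿ 1# - n ×ᴿ 1#                ≈⟨ +-congʳ (sym (+-identityˡ _)) ⟩
    (0# + m ×ᴿ 1#) - n ×ᴿ 1#         ≈⟨ +-congʳ (+-congʳ (sym (-‿inverseʳ 1#))) ⟩
    ((1# - 1#) + m ×ᴿ 1#) - n ×ᴿ 1#  ≈⟨ +-congʳ (+-assoc _ _ _) ⟩
    (1# + (- 1# + m ×ᴿ 1#)) - n ×ᴿ 1# ≈⟨ +-congʳ (+-congˡ (+-comm _ _)) ⟩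
    (1# + (m ×ᴿ 1# - 1#)) - n ×ᴿ 1#  ≈⟨ +-congʳ (sym (+-assoc _ _ _)) ⟩
    ((1# + m ×ᴿ 1#) - 1#) - n ×ᴿ 1#  ≈⟨ +-assoc _ _ _ ⟩
    (1# + m ×ᴿ 1#) + (- 1# - n ×ᴿ 1#) ≈⟨ +-congˡ (-‿+-comm _ _) ⟩
    (1# + m ×ᴿ 1#) - (1# + n ×ᴿ 1#)  ≈⟨ +-cong (sym (×-homo-+ 1# 1 m)) (-‿cong (sym (×-homo-+ 1# 1 n))) ⟩
    suc m ×ᴿ 1# - suc n ×ᴿ 1#        ∎

  fromℤ-+ : ∀ i j → fromℤ (i ℤ.+ j) ≈ fromℤ i + fromℤ j
  fromℤ-+ (+ m)    (+ n)    = ×-homo-+ 1# m n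
  fromℤ-+ (+ m)    -[1+ n ] = fromℤ-⊖ m (suc n)
  fromℤ-+ -[1+ m ] (+ n)    = trans (fromℤ-⊖ n (suc m)) (+-comm _ _)
  fromℤ-+ -[1+ m ] -[1+ n ] = begin
    - (suc (suc m ℕ.+ n) ×ᴿ 1#)        ≡⟨ ≡.cong (λ k → - (suc k ×ᴿ 1#)) (ℕP.+-suc m n) ⟨
    - ((suc m ℕ.+ suc n) ×ᴿ 1#)        ≈⟨ -‿cong (×-homo-+ 1# (suc m) (suc n)) ⟩
    - (suc m ×ᴿ 1# + suc n ×ᴿ 1#)       ≈⟨ -‿+-comm _ _ ⟨
    - (suc m ×ᴿ 1#) - (suc n ×ᴿ 1#)     ∎

  fromℤ-neg : ∀ i → fromℤ (ℤ.- i) ≈ - fromℤ i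
  fromℤ-neg -[1+ n ]  = sym (-‿involutive _)
  fromℤ-neg (+ zero)  = sym -0#≈0#
  fromℤ-neg (+ suc n) = refl

  fromℤ-*-pos : ∀ m j → fromℤ (+ m ℤ.* j) ≈ fromℤ (+ m) * fromℤ j
  fromℤ-*-pos m (+ n)    = trans (≡.subst (λ k → fromℤ k ≈ (m ℕ.* n) ×ᴿ 1#) (ℤ.pos-* m n) refl)
                                 (×1-homo-* m n)
  fromℤ-*-pos m -[1+ n ] = begin
    fromℤ (+ m ℤ.* -[1+ n ])         ≡⟨ ≡.cong fromℤ (ℤ.neg-distribʳ-* (+ m) (+ suc n)) ⟨
    fromℤ (ℤ.- (+ m ℤ.* + suc n))    ≈⟨ fromℤ-neg (+ m ℤ.* + suc n) ⟩
    - fromℤ (+ m ℤ.* + suc n)        ≈⟨ -‿cong (fromℤ-*-pos m (+ suc n)) ⟩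
    - (m ×ᴿ 1# * (suc n ×ᴿ 1#))        ≈⟨ -‿distribʳ-* _ _ ⟩
    m ×ᴿ 1# * - (suc n ×ᴿ 1#)          ∎

  fromℤ-* : ∀ i j → fromℤ (i ℤ.* j) ≈ fromℤ i * fromℤ j
  fromℤ-* (+ m)    j = fromℤ-*-pos m j
  fromℤ-* -[1+ m ] j = begin
    fromℤ (-[1+ m ] ℤ.* j)           ≡⟨ ≡.cong fromℤ (ℤ.neg-distribˡ-* (+ suc m) j) ⟨
    fromℤ (ℤ.- (+ suc m ℤ.* j))      ≈⟨ fromℤ-neg (+ suc m ℤ.* j) ⟩
    - fromℤ (+ suc m ℤ.* j)          ≈⟨ -‿cong (fromℤ-*-pos (suc m) j) ⟩
    - (suc m ×ᴿ 1# * fromℤ j)         ≈⟨ -‿distribˡ-* _ _ ⟩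
    - (suc m ×ᴿ 1#) * fromℤ j         ∎

  private
    almostCommutativeRing : ACR.AlmostCommutativeRing c ℓ
    almostCommutativeRing = ACR.fromCommutativeRing R

    fromℤ-homomorphism : ℤ.+-*-rawRing ACR.-Raw-AlmostCommutative⟶ almostCommutativeRing
    fromℤ-homomorphism = record
      { ⟦_⟧    = fromℤ
      ; +-homo = fromℤ-+
      ; *-homo = fromℤ-*
      ; -‿homo = fromℤ-neg
      ; 0-homo = refl
      ; 1-homo = refl
      }

    -- equal integer coefficients have equal images
    coefficientEquality : ∀ i j → Maybe (fromℤ i ≈ fromℤ j)
    coefficientEquality i j with i ℤ.≟ j
    ... | yes ≡.refl = just refl
    ... | no _       = nothing

  open import Algebra.Solver.Ring ℤ.+-*-rawRing almostCommutativeRing fromℤ-homomorphism coefficientEquality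
    public using (solve; _:+_; _:*_; :-_; _:-_; _:=_; con)

-- Elementary laws of the power function pow of the statement.
module Powers {c ℓ : Level} (R : CommutativeRing c ℓ) where
  open CommutativeRing R
  open import Relation.Binary.Reasoning.Setoid setoid

  pow-cong : ∀ {x y} n → x ≈ y → pow R x n ≈ pow R y n
  pow-cong zero    _   = refl
  pow-cong (suc n) x≈y = *-cong x≈y (pow-cong n x≈y)

  pow-congʳ : ∀ x {m n} → m ≡ n → pow R x m ≈ pow R x n
  pow-congʳ x ≡.refl = refl

  pow-+ : ∀ x m n → pow R x (m ℕ.+ n) ≈ pow R x m * pow R x n
  pow-+ x zero    n = sym (*-identityˡ _)
  pow-+ x (suc m) n = trans (*-congˡ (pow-+ x m n)) (sym (*-assoc _ _ _))

  pow-suc : ∀ x n → pow R x (n ℕ.+ 1) ≈ pow R x n * x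
  pow-suc x n = trans (pow-+ x n 1) (*-congˡ (*-identityʳ x))

  pow-1# : ∀ n → pow R 1# n ≈ 1#
  pow-1# zero    = refl
  pow-1# (suc n) = trans (*-identityˡ _) (pow-1# n)

  pow-0# : ∀ {n} → 1 ≤ n → pow R 0# n ≈ 0#
  pow-0# {suc n} _ = zeroˡ _

  pow-distrib-* : ∀ x y n → pow R (x * y) n ≈ pow R x n * pow R y n
  pow-distrib-* x y zero    = sym (*-identityˡ _)
  pow-distrib-* x y (suc n) = begin
    (x * y) * pow R (x * y) n        ≈⟨ *-congˡ (pow-distrib-* x y n) ⟩
    (x * y) * (pow R x n * pow R y n) ≈⟨ *-assoc _ _ _ ⟩
    x * (y * (pow R x n * pow R y n)) ≈⟨ *-congˡ (x∙yz≈y∙xz _ _ _) ⟩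
    x * (pow R x n * (y * pow R y n)) ≈⟨ *-assoc _ _ _ ⟨
    (x * pow R x n) * (y * pow R y n) ∎
    where open import Algebra.Properties.CommutativeSemigroup *-commutativeSemigroup using (x∙yz≈y∙xz)

  pow-* : ∀ x m n → pow R x (m ℕ.* n) ≈ pow R (pow R x m) n
  pow-* x zero    n = sym (pow-1# n)
  pow-* x (suc m) n = begin
    pow R x (n ℕ.+ m ℕ.* n)            ≈⟨ pow-+ x n (m ℕ.* n) ⟩
    pow R x n * pow R x (m ℕ.* n)      ≈⟨ *-congˡ (pow-* x m n) ⟩
    pow R x n * pow R (pow R x m) n    ≈⟨ pow-distrib-* x (pow R x m) n ⟨
    pow R (x * pow R x m) n            ∎

  -- powers of mutually inverse elements are mutually inverse
  pow-inverse : ∀ {x y} n → x * y ≈ 1# → pow R x n * pow R y n ≈ 1#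
  pow-inverse {x} {y} n xy≈1 = trans (sym (pow-distrib-* x y n)) (trans (pow-cong n xy≈1) (pow-1# n))

  -- a power map x ↦ x^N that is additive also commutes with negation
  additive-pow-neg : ∀ {N} → 1 ≤ N → (∀ x y → pow R (x + y) N ≈ pow R x N + pow R y N) →
                     ∀ x → pow R (- x) N ≈ - pow R x N
  additive-pow-neg {N} 1≤N additive x = begin
    pow R (- x) N                                  ≈⟨ +-identityʳ _ ⟨
    pow R (- x) N + 0#                             ≈⟨ +-congˡ (-‿inverseʳ _) ⟨
    pow R (- x) N + (pow R x N - pow R x N)        ≈⟨ +-assoc _ _ _ ⟨
    (pow R (- x) N + pow R x N) - pow R x N        ≈⟨ +-congʳ (additive (- x) x) ⟨
    pow R (- x + x) N - pow R x N                  ≈⟨ +-congʳ (pow-cong N (-‿inverseˡ x)) ⟩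
    pow R 0# N - pow R x N                         ≈⟨ +-congʳ (pow-0# 1≤N) ⟩
    0# - pow R x N                                 ≈⟨ +-identityˡ _ ⟩
    - pow R x N                                    ∎

  additive-pow-sub : ∀ {N} → 1 ≤ N → (∀ x y → pow R (x + y) N ≈ pow R x N + pow R y N) →
                     ∀ x y → pow R (x - y) N ≈ pow R x N - pow R y N
  additive-pow-sub 1≤N additive x y = trans (additive x (- y)) (+-congˡ (additive-pow-neg 1≤N additive y))

-- The binomial theorem: if every interior binomial coefficient (n C k),
-- 0 < k < n, acts as zero on R, then (x + y)^n = x^n + y^n.
module FreshmansDream {c ℓ : Level} (R : CommutativeRing c ℓ) where
  open CommutativeRing R
  open import Relation.Binary.Reasoning.Setoid setoid
  open import Data.Fin as Fin using (Fin; toℕ; inject₁)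
  import Data.Fin.Properties as Fin
  open import Data.Nat.Combinatorics using (_C_; nCn≡1)
  open import Algebra.Properties.Semiring.Exp semiring using (_^_)
  open import Algebra.Properties.Semiring.Mult semiring using (×-congˡ) renaming (_×_ to _×ᴿ_)
  open import Algebra.Properties.Semiring.Sum semiring using (sum; sum-init-last; sum-cong-≋; sum-replicate-zero)
  open import Algebra.Properties.CommutativeSemiring.Binomial commutativeSemiring
    using (theorem; binomialTerm)

  pow≈^ : ∀ x n → pow R x n ≈ x ^ n
  pow≈^ x zero    = refl
  pow≈^ x (suc n) = *-congˡ (pow≈^ x n)

  -- a sum over Fin (2 + m) whose interior terms vanish is the sum of its ends
  sum-ends : ∀ m (f : Fin (suc (suc m)) → Carrier) →
             (∀ (i : Fin m) → f (Fin.suc (inject₁ i)) ≈ 0#) →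
             sum f ≈ f Fin.zero + f (Fin.suc (Fin.fromℕ m))
  sum-ends m f interior = begin
    f Fin.zero + sum (λ i → f (Fin.suc i))
      ≈⟨ +-congˡ (sum-init-last (λ i → f (Fin.suc i))) ⟩
    f Fin.zero + (sum (λ i → f (Fin.suc (inject₁ i))) + f (Fin.suc (Fin.fromℕ m)))
      ≈⟨ +-congˡ (+-congʳ (trans (sum-cong-≋ {m} interior) (sum-replicate-zero m))) ⟩
    f Fin.zero + (0# + f (Fin.suc (Fin.fromℕ m)))
      ≈⟨ +-congˡ (+-identityˡ _) ⟩
    f Fin.zero + f (Fin.suc (Fin.fromℕ m)) ∎

  interior-vanishes⇒additive :
    ∀ n → 1 ≤ n → (∀ k → 0 < k → k < n → ∀ z → (n C k) ×ᴿ z ≈ 0#) →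
    ∀ x y → pow R (x + y) n ≈ pow R x n + pow R y n
  interior-vanishes⇒additive n@(suc m) (s≤s z≤n) interior x y = begin
    pow R (x + y) n            ≈⟨ pow≈^ (x + y) n ⟩
    (x + y) ^ n                ≈⟨ theorem n x y ⟩
    sum (binomialTerm x y n)   ≈⟨ sum-ends m (binomialTerm x y n) middle ⟩
    binomialTerm x y n Fin.zero + binomialTerm x y n (Fin.suc (Fin.fromℕ m))
                               ≈⟨ +-comm _ _ ⟩
    binomialTerm x y n (Fin.suc (Fin.fromℕ m)) + binomialTerm x y n Fin.zero
                               ≈⟨ +-cong lastTerm firstTerm ⟩
    pow R x n + pow R y n      ∎
    where
    middle : ∀ (i : Fin m) → binomialTerm x y n (Fin.suc (inject₁ i)) ≈ 0#
    middle i = interior _ (s≤s z≤n)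
      (s≤s (≡.subst (_< m) (≡.sym (Fin.toℕ-inject₁ i)) (Fin.toℕ<n i))) _
    firstTerm : binomialTerm x y n Fin.zero ≈ pow R y n
    firstTerm = trans (+-identityʳ _) (trans (*-identityˡ _) (sym (pow≈^ y n)))
    -- the last index is n itself, whatever its Fin representation
    lastTerm : binomialTerm x y n (Fin.suc (Fin.fromℕ m)) ≈ pow R x n
    lastTerm = top (toℕ (Fin.suc (Fin.fromℕ m))) (≡.cong suc (Fin.toℕ-fromℕ m))
      where
      top : ∀ k → k ≡ n → (n C k) ×ᴿ (x ^ k * y ^ (n ℕ.∸ k)) ≈ pow R x n
      top k ≡.refl = begin
        (n C n) ×ᴿ (x ^ n * y ^ (n ℕ.∸ n)) ≈⟨ ×-congˡ (nCn≡1 n) ⟩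
        1 ×ᴿ (x ^ n * y ^ (n ℕ.∸ n))       ≈⟨ +-identityʳ _ ⟩
        x ^ n * y ^ (n ℕ.∸ n)             ≡⟨ ≡.cong (λ j → x ^ n * y ^ j) (ℕP.n∸n≡0 n) ⟩
        x ^ n * 1#                        ≈⟨ *-identityʳ _ ⟩
        x ^ n                             ≈⟨ pow≈^ x n ⟨
        pow R x n                         ∎

-- In a commutative ring of prime characteristic p, x ↦ x^p is additive, and
-- so are its iterates x ↦ x^(p^n).
module Frobenius {c ℓ : Level} (R : CommutativeRing c ℓ) (p : ℕ) (p-prime : Prime p)
                 (p≈0 : CommutativeRing._≈_ R (fromℕ R p) (CommutativeRing.0# R)) where
  open CommutativeRing R
  open import Relation.Binary.Reasoning.Setoid setoid
  open import Data.Nat.Divisibility using (_∣_; divides)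
  open import Algebra.Properties.Semiring.Mult semiring using (×-assoc-*) renaming (_×_ to _×ᴿ_)
  open import Algebra.Properties.Monoid.Mult +-monoid using (×-assocˡ; ×-congʳ; ×-homo-0)
  open Powers R
  open PrimeBinomial using (prime≥2; prime∣binomial)

  p≥1 : 1 ≤ p
  p≥1 = ℕP.≤-trans (s≤s z≤n) (prime≥2 p-prime)

  p^n≥1 : ∀ n → 1 ≤ p ℕ.^ n
  p^n≥1 n = ℕP.m^n>0 p {{ℕ.>-nonZero p≥1}} n

  fromℕ≈×1# : ∀ n → fromℕ R n ≈ n ×ᴿ 1#
  fromℕ≈×1# zero    = refl
  fromℕ≈×1# (suc n) = +-congˡ (fromℕ≈×1# n)

  -- every multiple of p acts as zero
  multiple-of-p-vanishes : ∀ {n} x → p ∣ n → n ×ᴿ x ≈ 0#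
  multiple-of-p-vanishes x (divides m ≡.refl) = begin
    (m ℕ.* p) ×ᴿ x          ≈⟨ ×-assocˡ x m p ⟨
    m ×ᴿ (p ×ᴿ x)           ≈⟨ ×-congʳ m (trans (×-assoc-* p 1# x) (×-congʳ p (*-identityˡ x))) ⟨
    m ×ᴿ ((p ×ᴿ 1#) * x)    ≈⟨ ×-congʳ m (*-congʳ (trans (sym (fromℕ≈×1# p)) p≈0)) ⟩
    m ×ᴿ (0# * x)           ≈⟨ ×-congʳ m (zeroˡ x) ⟩
    m ×ᴿ 0#                 ≈⟨ ×-congʳ m (sym (×-homo-0 0#)) ⟩
    m ×ᴿ (0 ×ᴿ 0#)          ≈⟨ ×-assocˡ 0# m 0 ⟩
    (m ℕ.* 0) ×ᴿ 0#         ≡⟨ ≡.cong (_×ᴿ 0#) (ℕP.*-zeroʳ m) ⟩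
    0#                      ∎

  frobenius-+ : ∀ x y → pow R (x + y) p ≈ pow R x p + pow R y p
  frobenius-+ = FreshmansDream.interior-vanishes⇒additive R p p≥1
    (λ k 0<k k<p z → multiple-of-p-vanishes z (prime∣binomial p-prime k 0<k k<p))

  frobeniusⁿ-+ : ∀ n x y → pow R (x + y) (p ℕ.^ n) ≈ pow R x (p ℕ.^ n) + pow R y (p ℕ.^ n)
  frobeniusⁿ-+ zero    x y = trans (*-identityʳ _) (sym (+-cong (*-identityʳ x) (*-identityʳ y)))
  frobeniusⁿ-+ (suc n) x y = begin
    pow R (x + y) (p ℕ.* p ℕ.^ n)                    ≈⟨ pow-* (x + y) p (p ℕ.^ n) ⟩
    pow R (pow R (x + y) p) (p ℕ.^ n)                ≈⟨ pow-cong (p ℕ.^ n) (frobenius-+ x y) ⟩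
    pow R (pow R x p + pow R y p) (p ℕ.^ n)          ≈⟨ frobeniusⁿ-+ n _ _ ⟩
    pow R (pow R x p) (p ℕ.^ n) + pow R (pow R y p) (p ℕ.^ n)
                                                     ≈⟨ +-cong (pow-* x p (p ℕ.^ n)) (pow-* y p (p ℕ.^ n)) ⟨
    pow R x (p ℕ.* p ℕ.^ n) + pow R y (p ℕ.* p ℕ.^ n) ∎

-- Roots of sparse monic polynomials.  The closure hypothesis AlgClosed only
-- provides roots of monic polynomials x^(L+1) + Σ_{i<L} c_i x^i, whose
-- x^L-coefficient is zero.  A monic polynomial f of degree N ≥ 1 is reduced
-- to this shape by substituting x = y²: the coefficient of y^(2N-1) in
-- f(y²) vanishes, and y² is a root of f whenever y is a root of f(y²).
module SparseRoots {c ℓ : Level} (R : CommutativeRing c ℓ) (algClosed : AlgClosed R) where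
  open CommutativeRing R
  open import Relation.Binary.Reasoning.Setoid setoid
  open import Data.List using (List; []; _∷_; length; replicate)
  import Data.List.Properties as List
  open import Data.List.Relation.Unary.All as All using (All; []; _∷_)
  open Powers R

  -- a sparse polynomial: a list of terms (coefficient , exponent)
  Terms : Set c
  Terms = List (Carrier × ℕ)

  evalTerms : Terms → Carrier → Carrier
  evalTerms []             x = 0#
  evalTerms ((k , m) ∷ ts) x = k * pow R x m + evalTerms ts x

  ExponentsBelow : ℕ → Terms → Set c
  ExponentsBelow L = All (λ t → proj₂ t < L)

  -- adding k x^m to a dense coefficient list (constant term first)
  addTerm : ℕ → Carrier → List Carrier → List Carrier
  addTerm _       k []       = []
  addTerm zero    k (a ∷ cs) = (k + a) ∷ cs
  addTerm (suc m) k (a ∷ cs) = a ∷ addTerm m k cs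

  length-addTerm : ∀ m k cs → length (addTerm m k cs) ≡ length cs
  length-addTerm _       k []       = ≡.refl
  length-addTerm zero    k (a ∷ cs) = ≡.refl
  length-addTerm (suc m) k (a ∷ cs) = ≡.cong suc (length-addTerm m k cs)

  evalPoly-addTerm : ∀ m k cs x → m < length cs →
                     evalPoly R (addTerm m k cs) x ≈ k * pow R x m + evalPoly R cs x
  evalPoly-addTerm zero    k (a ∷ cs) x _ = begin
    (k + a) + x * evalPoly R cs x      ≈⟨ +-assoc _ _ _ ⟩
    k + (a + x * evalPoly R cs x)      ≈⟨ +-congʳ (*-identityʳ k) ⟨
    k * 1# + (a + x * evalPoly R cs x) ∎
  evalPoly-addTerm (suc m) k (a ∷ cs) x (s≤s m<) = begin
    a + x * evalPoly R (addTerm m k cs) x        ≈⟨ +-congˡ (*-congˡ (evalPoly-addTerm m k cs x m<)) ⟩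
    a + x * (k * pow R x m + evalPoly R cs x)    ≈⟨ +-congˡ (distribˡ _ _ _) ⟩
    a + (x * (k * pow R x m) + x * evalPoly R cs x) ≈⟨ +-congˡ (+-congʳ (x∙yz≈y∙xz x k _)) ⟩
    a + (k * (x * pow R x m) + x * evalPoly R cs x) ≈⟨ +-x∙yz≈y∙xz a _ _ ⟩
    k * (x * pow R x m) + (a + x * evalPoly R cs x) ∎
    where
    open import Algebra.Properties.CommutativeSemigroup *-commutativeSemigroup using (x∙yz≈y∙xz)
    open import Algebra.Properties.CommutativeSemigroup +-commutativeSemigroup
      using () renaming (x∙yz≈y∙xz to +-x∙yz≈y∙xz)

  -- the dense coefficient list of length L of a sparse polynomial
  dense : ℕ → Terms → List Carrier
  dense L []             = replicate L 0#
  dense L ((k , m) ∷ ts) = addTerm m k (dense L ts)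

  length-dense : ∀ L ts → length (dense L ts) ≡ L
  length-dense L []             = List.length-replicate L
  length-dense L ((k , m) ∷ ts) = ≡.trans (length-addTerm m k (dense L ts)) (length-dense L ts)

  evalPoly-zeros : ∀ L x → evalPoly R (replicate L 0#) x ≈ 0#
  evalPoly-zeros zero    x = refl
  evalPoly-zeros (suc L) x = trans (+-identityˡ _) (trans (*-congˡ (evalPoly-zeros L x)) (zeroʳ x))

  evalPoly-dense : ∀ L ts x → ExponentsBelow L ts → evalPoly R (dense L ts) x ≈ evalTerms ts x
  evalPoly-dense L []             x []           = evalPoly-zeros L x
  evalPoly-dense L ((k , m) ∷ ts) x (m<L ∷ ts<L) = begin
    evalPoly R (addTerm m k (dense L ts)) x  ≈⟨ evalPoly-addTerm m k (dense L ts) x m<length ⟩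
    k * pow R x m + evalPoly R (dense L ts) x ≈⟨ +-congˡ (evalPoly-dense L ts x ts<L) ⟩
    k * pow R x m + evalTerms ts x           ∎
    where
    m<length : m < length (dense L ts)
    m<length = ≡.subst (m <_) (≡.sym (length-dense L ts)) m<L

  -- the substitution x = y²
  squareExponents : Terms → Terms
  squareExponents []             = []
  squareExponents ((k , m) ∷ ts) = (k , m ℕ.* 2) ∷ squareExponents ts

  evalTerms-square : ∀ ts y → evalTerms (squareExponents ts) y ≈ evalTerms ts (pow R y 2)
  evalTerms-square []             y = refl
  evalTerms-square ((k , m) ∷ ts) y =
    +-cong (*-congˡ (trans (pow-congʳ y (ℕP.*-comm m 2)) (pow-* y 2 m))) (evalTerms-square ts y)

  -- exponents m < N become 2m ≤ 2N - 2 < 2N - 1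
  squareExponents-below : ∀ {n ts} → ExponentsBelow (suc n) ts →
                          ExponentsBelow (suc (n ℕ.* 2)) (squareExponents ts)
  squareExponents-below []                 = []
  squareExponents-below (s≤s m≤n ∷ ts<N) = s≤s (ℕP.*-monoˡ-≤ 2 m≤n) ∷ squareExponents-below ts<N

  -- every monic polynomial x^N + Σ k x^m (m < N) of degree N ≥ 1 has a root
  monic-root : ∀ N → 1 ≤ N → ∀ ts → ExponentsBelow N ts → ∃ λ x → pow R x N + evalTerms ts x ≈ 0#
  monic-root N@(suc n) _ ts ts<N = pow R y 2 , (begin
    pow R (pow R y 2) N + evalTerms ts (pow R y 2)
      ≈⟨ +-cong (pow-* y 2 N) (evalTerms-square ts y) ⟨
    pow R y (2 ℕ.* N) + evalTerms (squareExponents ts) y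
      ≈⟨ +-cong (pow-congʳ y degree) (evalPoly-dense L (squareExponents ts) y (squareExponents-below ts<N)) ⟨
    pow R y (suc (length cs)) + evalPoly R cs y
      ≈⟨ proj₂ (algClosed cs) ⟩
    0# ∎)
    where
    L : ℕ
    L = suc (n ℕ.* 2)
    cs : List Carrier
    cs = dense L (squareExponents ts)
    y : Carrier
    y = proj₁ (algClosed cs)
    degree : suc (length cs) ≡ 2 ℕ.* N
    degree = ≡.trans (≡.cong suc (length-dense L (squareExponents ts))) (ℕP.*-comm (suc n) 2)

-- [Q,Q] ⊆ Q₀.  The first coordinate x ↦ a(x) is multiplicative and its
-- values a(x) are units (a^(q+1) = 1), so in x·y = z·(y·x) the factor a(z)
-- cancels to 1; a product of elements with a = 1 again has a = 1.
module CommutatorsAreUnipotent {c ℓ : Level} (R : CommutativeRing c ℓ) (p e : ℕ) where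
  open CommutativeRing R
  open import Relation.Binary.Reasoning.Setoid setoid
  open Powers R

  private
    q : ℕ
    q = p ℕ.^ e

  -- a ∈ μ_(q+1) is a unit with inverse a^q
  μ-unit : ∀ {a} → pow R a (q ℕ.+ 1) ≈ 1# → pow R a q * a ≈ 1#
  μ-unit {a} a^[q+1]≈1 = trans (sym (pow-suc a q)) a^[q+1]≈1

  -- cancelling a unit u from  α · u ≈ u
  cancel-unit : ∀ {α u u⁻¹} → α * u ≈ u → u * u⁻¹ ≈ 1# → α ≈ 1#
  cancel-unit {α} {u} {u⁻¹} αu≈u uu⁻¹≈1 = begin
    α               ≈⟨ *-identityʳ α ⟨
    α * 1#          ≈⟨ *-congˡ uu⁻¹≈1 ⟨
    α * (u * u⁻¹)   ≈⟨ *-assoc _ _ _ ⟨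
    (α * u) * u⁻¹   ≈⟨ *-congʳ αu≈u ⟩
    u * u⁻¹         ≈⟨ uu⁻¹≈1 ⟩
    1#              ∎

  commutator-a≈1 : ∀ {z} → IsCommutator R p e z → a z ≈ 1#
  commutator-a≈1 {g a₃ _ _} (g a₁ _ _ , g a₂ _ _ , (a₁∈μ , _) , (a₂∈μ , _) , (xy≈zyx , _)) =
    cancel-unit {u⁻¹ = pow R a₂ q * pow R a₁ q} (trans (sym xy≈zyx) (*-comm a₁ a₂)) (begin
      a₂ * a₁ * (pow R a₂ q * pow R a₁ q)   ≈⟨ *-congˡ (*-comm _ _) ⟩
      a₂ * a₁ * (pow R a₁ q * pow R a₂ q)   ≈⟨ *-assoc _ _ _ ⟩
      a₂ * (a₁ * (pow R a₁ q * pow R a₂ q)) ≈⟨ *-congˡ (*-assoc _ _ _) ⟨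
      a₂ * ((a₁ * pow R a₁ q) * pow R a₂ q) ≈⟨ *-congˡ (*-congʳ (trans (*-comm _ _) (μ-unit a₁∈μ))) ⟩
      a₂ * (1# * pow R a₂ q)                ≈⟨ *-congˡ (*-identityˡ _) ⟩
      a₂ * pow R a₂ q                       ≈⟨ trans (*-comm _ _) (μ-unit a₂∈μ) ⟩
      1#                                    ∎)

  commutatorSubgroup-a≈1 : ∀ {t} → InCommutatorSubgroup R p e t → a t ≈ 1#
  commutatorSubgroup-a≈1 {g _ _ _} (unit (a≈1 , _)) = a≈1
  commutatorSubgroup-a≈1 {g _ _ _} (step {g _ _ _} {g _ _ _} h∈[Q,Q] _ z-comm (w≈hz , _)) =
    trans w≈hz (trans (*-cong (commutatorSubgroup-a≈1 h∈[Q,Q]) (commutator-a≈1 z-comm)) (*-identityˡ 1#))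

-- Q₀ ⊆ [Q,Q] over an algebraically closed field R of characteristic p.  The
-- module fixes the auxiliary roots the construction needs: v with
-- v^q + v + 1 = 0 (giving a₀ = 1 + v⁻¹ ∈ μ_(q+1)) and ζ with ζ^(q²) = -ζ.
module UnipotentsAreCommutators {c ℓ : Level} (R : CommutativeRing c ℓ) (p e : ℕ)
    (p-prime : Prime p) (p≈0 : CommutativeRing._≈_ R (fromℕ R p) (CommutativeRing.0# R))
    (isField : IsField R) (algClosed : AlgClosed R) (1≤e : 1 ≤ e) where
  open CommutativeRing R
  open import Relation.Binary.Reasoning.Setoid setoid
  open import Data.Integer using (0ℤ; 1ℤ)
  open import Data.List using ([]; _∷_)
  open import Data.List.Relation.Unary.All as All using ([]; _∷_)
  open IntegerCoefficientSolver R using (solve; _:+_; _:*_; :-_; _:-_; _:=_; con)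
  open import Algebra.Properties.Ring ring using (-‿involutive; -0#≈0#)
  open Powers R
  open Frobenius R p p-prime p≈0
  open SparseRoots R algClosed
  open PrimeBinomial using (prime≥2)

  q : ℕ
  q = p ℕ.^ e

  p≥2 : 2 ≤ p
  p≥2 = prime≥2 p-prime

  q≥2 : 2 ≤ q
  q≥2 = ℕP.≤-trans p≥2 (ℕP.≤-trans (ℕP.≤-reflexive (≡.sym (ℕP.*-identityʳ p)))
          (ℕP.^-monoʳ-≤ p {{ℕ.>-nonZero p≥1}} 1≤e))

  q≥1 : 1 ≤ q
  q≥1 = p^n≥1 e

  -- x ↦ x^q and x ↦ x^p are additive, hence commute with negation and subtraction
  frobeniusq-+ : ∀ x y → pow R (x + y) q ≈ pow R x q + pow R y q
  frobeniusq-+ = frobeniusⁿ-+ e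

  frobeniusq-neg : ∀ x → pow R (- x) q ≈ - pow R x q
  frobeniusq-neg = additive-pow-neg q≥1 frobeniusq-+

  frobeniusq-sub : ∀ x y → pow R (x - y) q ≈ pow R x q - pow R y q
  frobeniusq-sub = additive-pow-sub q≥1 frobeniusq-+

  frobeniusp-neg : ∀ x → pow R (- x) p ≈ - pow R x p
  frobeniusp-neg = additive-pow-neg p≥1 frobenius-+

  frobeniusp-sub : ∀ x y → pow R (x - y) p ≈ pow R x p - pow R y p
  frobeniusp-sub = additive-pow-sub p≥1 frobenius-+

  -- the exponent p^(2e) of the definition of Q is q·q
  pow-q² : ∀ x → pow R x (p ℕ.^ (2 ℕ.* e)) ≈ pow R (pow R x q) q
  pow-q² x = trans (pow-congʳ x p^2e≡q*q) (pow-* x q q)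
    where
    p^2e≡q*q : p ℕ.^ (2 ℕ.* e) ≡ q ℕ.* q
    p^2e≡q*q = ≡.trans (≡.cong (p ℕ.^_) (≡.cong (e ℕ.+_) (ℕP.+-identityʳ e)))
                       (ℕP.^-distribˡ-+-* p e e)

  -- the Frobenius sum  T_n(x) = Σ_{i<n} x^(p^i)
  T : ℕ → Carrier → Carrier
  T = frobSum R p e

  T-cong : ∀ n {x y} → x ≈ y → T n x ≈ T n y
  T-cong zero    _   = refl
  T-cong (suc n) x≈y = +-cong (T-cong n x≈y) (pow-cong (p ℕ.^ n) x≈y)

  T-zero : ∀ n {x} → x ≈ 0# → T n x ≈ 0#
  T-zero zero    _   = refl
  T-zero (suc n) x≈0 = trans (+-cong (T-zero n x≈0) (trans (pow-cong (p ℕ.^ n) x≈0) (pow-0# (p^n≥1 n))))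
                             (+-identityʳ 0#)

  T-+ : ∀ n x y → T n (x + y) ≈ T n x + T n y
  T-+ zero    x y = sym (+-identityˡ 0#)
  T-+ (suc n) x y = begin
    T n (x + y) + pow R (x + y) (p ℕ.^ n)                 ≈⟨ +-cong (T-+ n x y) (frobeniusⁿ-+ n x y) ⟩
    (T n x + T n y) + (pow R x (p ℕ.^ n) + pow R y (p ℕ.^ n))
      ≈⟨ solve 4 (λ a b c d → (a :+ b) :+ (c :+ d) := (a :+ c) :+ (b :+ d)) refl _ _ _ _ ⟩
    (T n x + pow R x (p ℕ.^ n)) + (T n y + pow R y (p ℕ.^ n)) ∎

  -- T_n(x)^p telescopes:  T_n(x)^p = T_n(x) - x + x^(p^n)
  T-pow : ∀ n x → pow R (T n x) p ≈ T n x - x + pow R x (p ℕ.^ n)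
  T-pow zero    x = begin
    pow R 0# p             ≈⟨ pow-0# p≥1 ⟩
    0#                     ≈⟨ solve 1 (λ x → con 0ℤ := con 0ℤ :- x :+ x) refl x ⟩
    0# - x + x             ≈⟨ +-congˡ (*-identityʳ x) ⟨
    0# - x + x * 1#        ∎
  T-pow (suc n) x = begin
    pow R (T n x + pow R x (p ℕ.^ n)) p                        ≈⟨ frobenius-+ _ _ ⟩
    pow R (T n x) p + pow R (pow R x (p ℕ.^ n)) p              ≈⟨ +-cong (T-pow n x) (sym (pow-* x (p ℕ.^ n) p)) ⟩
    (T n x - x + pow R x (p ℕ.^ n)) + pow R x (p ℕ.^ n ℕ.* p)
      ≈⟨ solve 4 (λ t x y z → (t :- x :+ y) :+ z := (t :+ y) :- x :+ z) refl _ _ _ _ ⟩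
    (T n x + pow R x (p ℕ.^ n)) - x + pow R x (p ℕ.^ n ℕ.* p)  ≈⟨ +-congˡ (pow-congʳ x (ℕP.*-comm (p ℕ.^ n) p)) ⟩
    (T n x + pow R x (p ℕ.^ n)) - x + pow R x (p ℕ.* p ℕ.^ n)  ∎

  -- a small solver-checked rearrangement used to read off roots
  x+y≈0⇒x≈-y : ∀ {x y} → x + y ≈ 0# → x ≈ - y
  x+y≈0⇒x≈-y {x} {y} x+y≈0 = begin
    x            ≈⟨ solve 2 (λ x y → x := (x :+ y) :- y) refl x y ⟩
    (x + y) - y  ≈⟨ +-congʳ x+y≈0 ⟩
    0# - y       ≈⟨ +-identityˡ _ ⟩
    - y          ∎

  x≈y⇒x-y≈0 : ∀ {x y} → x ≈ y → x - y ≈ 0#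
  x≈y⇒x-y≈0 {x} {y} x≈y = trans (+-congʳ x≈y) (-‿inverseʳ y)

  -- Artin–Schreier equations x^N - x + k = 0 (N ≥ 2) are solvable
  artinSchreier-root : ∀ {N} → 2 ≤ N → ∀ k → ∃ λ x → pow R x N - x + k ≈ 0#
  artinSchreier-root {N} 2≤N k = x , (begin
    pow R x N - x + k
      ≈⟨ solve 3 (λ X x k → X :- x :+ k := X :+ (:- con 1ℤ :* (x :* con 1ℤ) :+ (k :* con 1ℤ :+ con 0ℤ))) refl _ x k ⟩
    pow R x N + evalTerms ((- 1# , 1) ∷ (k , 0) ∷ []) x
      ≈⟨ x-root ⟩
    0#   ∎)
    where
    1≤N : 1 ≤ N
    1≤N = ℕP.≤-trans (s≤s z≤n) 2≤N
    root : ∃ λ x → pow R x N + evalTerms ((- 1# , 1) ∷ (k , 0) ∷ []) x ≈ 0#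
    root = monic-root N 1≤N _ (2≤N ∷ 1≤N ∷ [])
    x : Carrier
    x = proj₁ root
    x-root : pow R x N + evalTerms ((- 1# , 1) ∷ (k , 0) ∷ []) x ≈ 0#
    x-root = proj₂ root

  -- the terms of T_n(w) - d
  frobSumTerms : Carrier → ℕ → Terms
  frobSumTerms d zero    = (- d , 0) ∷ []
  frobSumTerms d (suc n) = (1# , p ℕ.^ n) ∷ frobSumTerms d n

  evalTerms-frobSum : ∀ d n w → evalTerms (frobSumTerms d n) w ≈ T n w - d
  evalTerms-frobSum d zero    w = solve 1 (λ d → :- d :* con 1ℤ :+ con 0ℤ := con 0ℤ :- d) refl d
  evalTerms-frobSum d (suc n) w = begin
    1# * pow R w (p ℕ.^ n) + evalTerms (frobSumTerms d n) w ≈⟨ +-congˡ (evalTerms-frobSum d n w) ⟩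
    1# * pow R w (p ℕ.^ n) + (T n w - d)
      ≈⟨ solve 3 (λ X t d → con 1ℤ :* X :+ (t :- d) := t :+ X :- d) refl _ _ d ⟩
    T n w + pow R w (p ℕ.^ n) - d                          ∎

  frobSumTerms-below : ∀ d n → ExponentsBelow (p ℕ.^ n) (frobSumTerms d n)
  frobSumTerms-below d zero    = s≤s z≤n ∷ []
  frobSumTerms-below d (suc n) =
    p^n<p^[1+n] ∷ All.map (λ m< → ℕP.<-trans m< p^n<p^[1+n]) (frobSumTerms-below d n)
    where
    p^n<p^[1+n] : p ℕ.^ n < p ℕ.^ suc n
    p^n<p^[1+n] = ℕP.^-monoʳ-< p p≥2 (ℕP.n<1+n n)

  -- T_n is surjective for n ≥ 1: T_n(w) = d is a monic equation of degree p^(n-1)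
  T-surjective : ∀ n → 1 ≤ n → ∀ d → ∃ λ w → T n w ≈ d
  T-surjective (suc n) _ d = w , (begin
    T n w + pow R w (p ℕ.^ n)                ≈⟨ solve 3 (λ t X d → t :+ X := (X :+ (t :- d)) :+ d) refl _ _ d ⟩
    (pow R w (p ℕ.^ n) + (T n w - d)) + d    ≈⟨ +-congʳ (trans (+-congˡ (sym (evalTerms-frobSum d n w))) w-root) ⟩
    0# + d                                   ≈⟨ +-identityˡ d ⟩
    d                                        ∎)
    where
    root : ∃ λ w → pow R w (p ℕ.^ n) + evalTerms (frobSumTerms d n) w ≈ 0#
    root = monic-root (p ℕ.^ n) (p^n≥1 n) (frobSumTerms d n) (frobSumTerms-below d n)
    w : Carrier
    w = proj₁ root
    w-root : pow R w (p ℕ.^ n) + evalTerms (frobSumTerms d n) w ≈ 0#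
    w-root = proj₂ root

  -- an element that is not 0 (i.e. being 0 would force 1 = 0) is a unit
  invertible : ∀ {x} → (x ≈ 0# → 1# ≈ 0#) → ∃ λ x⁻¹ → x * x⁻¹ ≈ 1#
  invertible {x} x≈0⇒1≈0 = proj₂ isField x (λ x≈0 → proj₁ isField (x≈0⇒1≈0 x≈0))

  -- a root v of x^q + x + 1; it is a unit
  v-root : ∃ λ v → pow R v q ≈ - (1# + v)
  v-root = v , x+y≈0⇒x≈-y (trans (solve 2 (λ X v → X :+ (con 1ℤ :+ v) :=
                 X :+ (con 1ℤ :* (v :* con 1ℤ) :+ (con 1ℤ :* con 1ℤ :+ con 0ℤ))) refl _ v) v-is-root)
    where
    root : ∃ λ v → pow R v q + evalTerms ((1# , 1) ∷ (1# , 0) ∷ []) v ≈ 0#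
    root = monic-root q q≥1 _ (q≥2 ∷ q≥1 ∷ [])
    v : Carrier
    v = proj₁ root
    v-is-root : pow R v q + evalTerms ((1# , 1) ∷ (1# , 0) ∷ []) v ≈ 0#
    v-is-root = proj₂ root

  v : Carrier
  v = proj₁ v-root

  v^q : pow R v q ≈ - (1# + v)
  v^q = proj₂ v-root

  v-invertible : ∃ λ v⁻¹ → v * v⁻¹ ≈ 1#
  v-invertible = invertible λ v≈0 → begin
    1#                   ≈⟨ solve 1 (λ v → con 1ℤ := :- (:- (con 1ℤ :+ v)) :- v) refl v ⟩
    - (- (1# + v)) - v   ≈⟨ +-congʳ (-‿cong v^q) ⟨
    - pow R v q - v      ≈⟨ +-cong (-‿cong (trans (pow-cong q v≈0) (pow-0# q≥1))) (-‿cong v≈0) ⟩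
    - 0# - 0#            ≈⟨ solve 0 (:- con 0ℤ :- con 0ℤ := con 0ℤ) refl ⟩
    0#                   ∎

  v⁻¹ : Carrier
  v⁻¹ = proj₁ v-invertible

  v*v⁻¹ : v * v⁻¹ ≈ 1#
  v*v⁻¹ = proj₂ v-invertible

  q²-1 : ℕ
  q²-1 = ℕ.pred (q ℕ.* q)

  1≤q²-1 : 1 ≤ q²-1
  1≤q²-1 = ℕP.pred-mono-≤ (ℕP.≤-trans q≥2 (ℕP.m≤m*n q q {{ℕ.>-nonZero q≥1}}))

  -- a root ζ of x^(q²-1) + 1, so that ζ^(q²) = -ζ; it is a unit
  ζ-root : ∃ λ ζ → pow R ζ q²-1 ≈ - 1#
  ζ-root = ζ , x+y≈0⇒x≈-y (trans (+-congˡ (sym (trans (+-identityʳ _) (*-identityˡ 1#)))) ζ-is-root)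
    where
    root : ∃ λ ζ → pow R ζ q²-1 + evalTerms ((1# , 0) ∷ []) ζ ≈ 0#
    root = monic-root q²-1 1≤q²-1 _ (1≤q²-1 ∷ [])
    ζ : Carrier
    ζ = proj₁ root
    ζ-is-root : pow R ζ q²-1 + evalTerms ((1# , 0) ∷ []) ζ ≈ 0#
    ζ-is-root = proj₂ root

  ζ : Carrier
  ζ = proj₁ ζ-root

  ζ^[q²] : pow R (pow R ζ q) q ≈ - ζ
  ζ^[q²] = begin
    pow R (pow R ζ q) q           ≈⟨ pow-* ζ q q ⟨
    pow R ζ (q ℕ.* q)             ≈⟨ pow-congʳ ζ q*q≡1+N ⟩
    ζ * pow R ζ q²-1              ≈⟨ *-congˡ (proj₂ ζ-root) ⟩
    ζ * - 1#                      ≈⟨ solve 1 (λ z → z :* :- con 1ℤ := :- z) refl ζ ⟩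
    - ζ                           ∎
    where
    q*q≡1+N : q ℕ.* q ≡ suc q²-1
    q*q≡1+N = ≡.sym (ℕP.suc-pred (q ℕ.* q) {{ℕ.>-nonZero (ℕP.*-mono-≤ q≥1 q≥1)}})

  ζ-invertible : ∃ λ ζ⁻¹ → ζ * ζ⁻¹ ≈ 1#
  ζ-invertible = invertible λ ζ≈0 → begin
    1#                  ≈⟨ -‿involutive 1# ⟨
    - (- 1#)            ≈⟨ -‿cong (proj₂ ζ-root) ⟨
    - pow R ζ q²-1      ≈⟨ -‿cong (trans (pow-cong q²-1 ζ≈0) (pow-0# 1≤q²-1)) ⟩
    - 0#                ≈⟨ -0#≈0# ⟩
    0#                  ∎

  ζ⁻¹ : Carrier
  ζ⁻¹ = proj₁ ζ-invertible

  ζ*ζ⁻¹ : ζ * ζ⁻¹ ≈ 1#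
  ζ*ζ⁻¹ = proj₂ ζ-invertible

  -- the Frobenius-sum term of a product whose left factor has b = 0 vanishes
  T-left-b≈0 : ∀ a x → T e (a * pow R 0# q * x) ≈ 0#
  T-left-b≈0 a x = T-zero e (trans (*-congʳ (trans (*-congˡ (pow-0# q≥1)) (zeroʳ a))) (zeroˡ x))

  -- the b-coordinates of elements of Q are the solutions of b^(q²) = -b
  Admissible : Carrier → Set ℓ
  Admissible b = pow R (pow R b q) q ≈ - b

  admissible-scale : ∀ {b x} → Admissible b → pow R (pow R x q) q ≈ x → Admissible (b * x)
  admissible-scale {b} {x} b^q²≈-b x^q²≈x = begin
    pow R (pow R (b * x) q) q                   ≈⟨ pow-cong q (pow-distrib-* b x q) ⟩
    pow R (pow R b q * pow R x q) q             ≈⟨ pow-distrib-* _ _ q ⟩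
    pow R (pow R b q) q * pow R (pow R x q) q   ≈⟨ *-cong b^q²≈-b x^q²≈x ⟩
    - b * x                                     ≈⟨ solve 2 (λ b x → :- b :* x := :- (b :* x)) refl b x ⟩
    - (b * x)                                   ∎

  -- g(1,b,c) ∈ Q  iff  b is admissible and c^p - c + b^(q+1) = 0
  unipotent∈Q : ∀ {b c} → Admissible b → pow R c p - c + pow R b (q ℕ.+ 1) ≈ 0# →
                InQ R p e (g 1# b c)
  unipotent∈Q {b} b^q²≈-b c-eq =
    pow-1# (q ℕ.+ 1) , trans (+-congʳ (trans (pow-q² b) b^q²≈-b)) (-‿inverseˡ b) , c-eq

  -- every admissible b is the b-coordinate of some g(1,b,c) ∈ Q
  unipotent-lift : ∀ {b} → Admissible b → ∃ λ c → InQ R p e (g 1# b c)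
  unipotent-lift {b} b^q²≈-b = proj₁ root , unipotent∈Q b^q²≈-b (proj₂ root)
    where
    root : ∃ λ c → pow R c p - c + pow R b (q ℕ.+ 1) ≈ 0#
    root = artinSchreier-root p≥2 (pow R b (q ℕ.+ 1))

  -- Artin–Schreier equations rearranged:  c^p - c + k = 0  ⇒  c^p = c - k
  artinSchreier-rearrange : ∀ {X x k} → X - x + k ≈ 0# → X ≈ x - k
  artinSchreier-rearrange {X} {x} {k} eq = begin
    X                        ≈⟨ solve 3 (λ X x k → X := (X :- x :+ k) :+ (x :- k)) refl X x k ⟩
    (X - x + k) + (x - k)    ≈⟨ +-congʳ eq ⟩
    0# + (x - k)             ≈⟨ +-identityˡ _ ⟩
    x - k                    ∎

  -- a₀ = 1 + v⁻¹ is an element of μ_(q+1) different from 1 (a₀ - 1 is a unit)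
  a₀ : Carrier
  a₀ = 1# + v⁻¹

  a₀∈μ : pow R a₀ (q ℕ.+ 1) ≈ 1#
  a₀∈μ = begin
    pow R a₀ (q ℕ.+ 1)                 ≈⟨ pow-suc a₀ q ⟩
    pow R a₀ q * a₀                    ≈⟨ *-congʳ (trans (frobeniusq-+ 1# v⁻¹) (+-congʳ (pow-1# q))) ⟩
    (1# + w) * (1# + v⁻¹)
      ≈⟨ solve 3 (λ v v⁻¹ w → (con 1ℤ :+ w) :* (con 1ℤ :+ v⁻¹) :=
           con 1ℤ :+ (:- v⁻¹) :* (w :* :- (con 1ℤ :+ v) :- con 1ℤ) :+ (:- w) :* (v :* v⁻¹ :- con 1ℤ)) refl v v⁻¹ w ⟩
    1# + (- v⁻¹) * (w * - (1# + v) - 1#) + (- w) * (v * v⁻¹ - 1#)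
      ≈⟨ +-cong (+-congˡ (*-congˡ (x≈y⇒x-y≈0 w*v^q))) (*-congˡ (x≈y⇒x-y≈0 v*v⁻¹)) ⟩
    1# + (- v⁻¹) * 0# + (- w) * 0#
      ≈⟨ solve 2 (λ a b → con 1ℤ :+ a :* con 0ℤ :+ b :* con 0ℤ := con 1ℤ) refl _ _ ⟩
    1#                                 ∎
    where
    w : Carrier
    w = pow R v⁻¹ q
    w*v^q : w * - (1# + v) ≈ 1#
    w*v^q = trans (*-congˡ (sym v^q)) (trans (*-comm _ _) (pow-inverse q v*v⁻¹))

  -- v^(q²) = v
  v^[q²] : pow R (pow R v q) q ≈ v
  v^[q²] = begin
    pow R (pow R v q) q            ≈⟨ pow-cong q v^q ⟩
    pow R (- (1# + v)) q           ≈⟨ frobeniusq-neg _ ⟩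
    - pow R (1# + v) q             ≈⟨ -‿cong (trans (frobeniusq-+ 1# v) (+-cong (pow-1# q) v^q)) ⟩
    - (1# + - (1# + v))            ≈⟨ solve 1 (λ v → :- (con 1ℤ :+ :- (con 1ℤ :+ v)) := v) refl v ⟩
    v                              ∎

  admissible-0# : Admissible 0#
  admissible-0# = trans (pow-cong q (pow-0# q≥1)) (trans (pow-0# q≥1) (sym -0#≈0#))

  -- the torus elements g(a,0,0), a ∈ μ_(q+1), lie in Q
  torus∈Q : ∀ {a} → pow R a (q ℕ.+ 1) ≈ 1# → InQ R p e (g a 0# 0#)
  torus∈Q a∈μ = a∈μ , proj₁ (proj₂ (unipotent∈Q admissible-0# c-eq)) , c-eq
    where
    c-eq : pow R 0# p - 0# + pow R 0# (q ℕ.+ 1) ≈ 0#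
    c-eq = trans (+-cong (+-cong (pow-0# p≥1) -0#≈0#) (pow-0# (ℕP.≤-trans q≥1 (ℕP.m≤m+n q 1))))
                 (trans (+-identityʳ _) (+-identityʳ 0#))

  -- the c-coordinate produced by commuting g(a₀,0,0) with g(1,βv,·)
  γ : Carrier → Carrier
  γ β = - T e (pow R β (q ℕ.+ 1) * v)

  -- g(1, β, γ(β)) lies in Q:  γ^p - γ + β^(q+1) = 0, computed with T-pow
  torusCommutator∈Q : ∀ {β} → Admissible β → InQ R p e (g 1# β (γ β))
  torusCommutator∈Q {β} β^q²≈-β = unipotent∈Q β^q²≈-β (begin
    pow R (γ β) p - γ β + B                        ≈⟨ +-congʳ (+-congʳ (trans (frobeniusp-neg _) (-‿cong (T-pow e Y)))) ⟩
    - (T e Y - Y + pow R Y q) - γ β + B            ≈⟨ +-cong (+-congʳ (-‿cong (+-cong (+-congˡ (-‿cong Y≈)) Y^q))) B≈ ⟩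
    - (T e Y - βq * β * v + (- β * βq) * - (1# + v)) - - T e Y + βq * β
      ≈⟨ solve 4 (λ t β βq v → :- (t :- βq :* β :* v :+ (:- β :* βq) :* :- (con 1ℤ :+ v)) :- :- t :+ βq :* β
                                := con 0ℤ) refl _ β _ v ⟩
    0#                                             ∎)
    where
    B βq Y : Carrier
    B  = pow R β (q ℕ.+ 1)
    βq = pow R β q
    Y  = B * v
    B≈ : B ≈ βq * β
    B≈ = pow-suc β q
    Y≈ : Y ≈ βq * β * v
    Y≈ = *-congʳ B≈
    Y^q : pow R Y q ≈ (- β * βq) * - (1# + v)
    Y^q = begin
      pow R (B * v) q                   ≈⟨ pow-distrib-* B v q ⟩
      pow R B q * pow R v q             ≈⟨ *-cong (trans (pow-cong q B≈) (pow-distrib-* βq β q)) v^q ⟩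
      (pow R βq q * βq) * - (1# + v)    ≈⟨ *-congʳ (*-congʳ β^q²≈-β) ⟩
      (- β * βq) * - (1# + v)           ∎

  _∙_ : Triple R → Triple R → Triple R
  _∙_ = _·_ R p e

  _≈Q_ : Triple R → Triple R → Set ℓ
  _≈Q_ = _≈T_ R

  -- g(1, β, γ(β)) = [g(a₀,0,0), g(1,βv,c′)] for a suitable c′
  torusCommutator : ∀ {β} → Admissible β → IsCommutator R p e (g 1# β (γ β))
  torusCommutator {β} β^q²≈-β =
    g a₀ 0# 0# , g 1# (β * v) c′ , torus∈Q a₀∈μ , y∈Q , (a-part , b-part , c-part)
    where
    lift : ∃ λ c′ → InQ R p e (g 1# (β * v) c′)
    lift = unipotent-lift (admissible-scale β^q²≈-β v^[q²])
    c′ : Carrier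
    c′ = proj₁ lift
    y∈Q : InQ R p e (g 1# (β * v) c′)
    y∈Q = proj₂ lift
    a-part : a₀ * 1# ≈ 1# * (1# * a₀)
    a-part = solve 1 (λ a → a :* con 1ℤ := con 1ℤ :* (con 1ℤ :* a)) refl a₀
    -- (a₀ - 1)·βv = β because a₀ - 1 = v⁻¹
    b-part : 0# + a₀ * (β * v) ≈ β + 1# * (β * v + 1# * 0#)
    b-part = begin
      0# + a₀ * (β * v)
        ≈⟨ solve 3 (λ β v v⁻¹ → con 0ℤ :+ (con 1ℤ :+ v⁻¹) :* (β :* v) :=
             β :+ con 1ℤ :* (β :* v :+ con 1ℤ :* con 0ℤ) :+ β :* (v :* v⁻¹ :- con 1ℤ)) refl β v v⁻¹ ⟩
      β + 1# * (β * v + 1# * 0#) + β * (v * v⁻¹ - 1#) ≈⟨ +-congˡ (*-congˡ (x≈y⇒x-y≈0 v*v⁻¹)) ⟩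
      β + 1# * (β * v + 1# * 0#) + β * 0#             ≈⟨ trans (+-congˡ (zeroʳ β)) (+-identityʳ _) ⟩
      β + 1# * (β * v + 1# * 0#)                      ∎
    -- the Frobenius sums of the two products differ by T(β^(q+1) v) = - γ(β)
    c-part : 0# + c′ + T e (a₀ * pow R 0# q * (β * v)) ≈
             γ β + (c′ + 0# + T e (1# * pow R (β * v) q * 0#)) + T e (1# * pow R β q * (β * v + 1# * 0#))
    c-part = begin
      0# + c′ + T e (a₀ * pow R 0# q * (β * v))
        ≈⟨ +-congˡ (T-left-b≈0 a₀ (β * v)) ⟩
      0# + c′ + 0#
        ≈⟨ solve 2 (λ c′ t → con 0ℤ :+ c′ :+ con 0ℤ := :- t :+ (c′ :+ con 0ℤ :+ con 0ℤ) :+ t) refl c′ _ ⟩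
      γ β + (c′ + 0# + 0#) + T e (pow R β (q ℕ.+ 1) * v)
        ≈⟨ +-cong (+-congˡ (+-congˡ (sym (T-zero e (zeroʳ _))))) (T-cong e B*v≈) ⟩
      γ β + (c′ + 0# + T e (1# * pow R (β * v) q * 0#)) + T e (1# * pow R β q * (β * v + 1# * 0#)) ∎
      where
      B*v≈ : pow R β (q ℕ.+ 1) * v ≈ 1# * pow R β q * (β * v + 1# * 0#)
      B*v≈ = trans (*-congʳ (pow-suc β q))
        (solve 3 (λ βq β v → βq :* β :* v := con 1ℤ :* βq :* (β :* v :+ con 1ℤ :* con 0ℤ)) refl _ β v)

  inverse-unique : ∀ {x y y′} → x * y ≈ 1# → x * y′ ≈ 1# → y ≈ y′
  inverse-unique {x} {y} {y′} xy≈1 xy′≈1 = begin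
    y               ≈⟨ *-identityʳ y ⟨
    y * 1#          ≈⟨ *-congˡ xy′≈1 ⟨
    y * (x * y′)    ≈⟨ solve 3 (λ x y y′ → y :* (x :* y′) := x :* y :* y′) refl x y y′ ⟩
    x * y * y′      ≈⟨ *-congʳ xy≈1 ⟩
    1# * y′         ≈⟨ *-identityˡ y′ ⟩
    y′              ∎

  -- u = ζ^(q+1) is a unit with u^q = -u, hence also (u⁻¹)^q = -u⁻¹
  u u⁻¹ : Carrier
  u   = pow R ζ q * ζ
  u⁻¹ = pow R ζ⁻¹ q * ζ⁻¹

  u*u⁻¹ : u * u⁻¹ ≈ 1#
  u*u⁻¹ = begin
    (pow R ζ q * ζ) * (pow R ζ⁻¹ q * ζ⁻¹)
      ≈⟨ solve 4 (λ a b c d → (a :* b) :* (c :* d) := (a :* c) :* (b :* d)) refl _ ζ _ ζ⁻¹ ⟩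
    (pow R ζ q * pow R ζ⁻¹ q) * (ζ * ζ⁻¹)   ≈⟨ *-cong (pow-inverse q ζ*ζ⁻¹) ζ*ζ⁻¹ ⟩
    1# * 1#                                  ≈⟨ *-identityˡ 1# ⟩
    1#                                       ∎

  u^q : pow R u q ≈ - u
  u^q = begin
    pow R (pow R ζ q * ζ) q         ≈⟨ pow-distrib-* _ ζ q ⟩
    pow R (pow R ζ q) q * pow R ζ q ≈⟨ *-congʳ ζ^[q²] ⟩
    - ζ * pow R ζ q                 ≈⟨ solve 2 (λ z zq → :- z :* zq := :- (zq :* z)) refl ζ _ ⟩
    - u                             ∎

  u⁻¹^q : pow R u⁻¹ q ≈ - u⁻¹
  u⁻¹^q = inverse-unique (trans (*-congʳ (sym u^q)) (pow-inverse q u*u⁻¹))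
    (trans (solve 2 (λ u u⁻¹ → :- u :* :- u⁻¹ := u :* u⁻¹) refl u u⁻¹) u*u⁻¹)

  -- if T(w) = d with d ∈ 𝔽_p, then w ∈ 𝔽_q:  w^q = T(w)^p - T(w) + w = w
  T-preimage-fixed : ∀ {w d} → T e w ≈ d → pow R d p ≈ d → pow R w q ≈ w
  T-preimage-fixed {w} {d} Tw≈d d^p≈d = begin
    pow R w q                               ≈⟨ solve 3 (λ w X t → X := (t :- w :+ X) :- t :+ w) refl w _ _ ⟩
    (T e w - w + pow R w q) - T e w + w     ≈⟨ +-congʳ (+-cong (sym (T-pow e w)) (-‿cong Tw≈d)) ⟩
    pow R (T e w) p - d + w                 ≈⟨ +-congʳ (x≈y⇒x-y≈0 (trans (pow-cong p Tw≈d) d^p≈d)) ⟩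
    0# + w                                  ≈⟨ +-identityˡ w ⟩
    w                                       ∎

  -- for m with m^q = -m there is s with s^q = s - m; then s^(q²) = s
  twisted-root : ∀ {m} → pow R m q ≈ - m → ∃ λ s → (pow R s q ≈ s - m) × (pow R (pow R s q) q ≈ s)
  twisted-root {m} m^q≈-m = s , s^q , (begin
    pow R (pow R s q) q            ≈⟨ pow-cong q s^q ⟩
    pow R (s - m) q                ≈⟨ frobeniusq-sub s m ⟩
    pow R s q - pow R m q          ≈⟨ +-cong s^q (-‿cong m^q≈-m) ⟩
    (s - m) - - m                  ≈⟨ solve 2 (λ s m → (s :- m) :- :- m := s) refl s m ⟩
    s                              ∎)
    where
    root : ∃ λ s → pow R s q - s + m ≈ 0#
    root = artinSchreier-root q≥2 m
    s : Carrier
    s = proj₁ root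
    s^q : pow R s q ≈ s - m
    s^q = artinSchreier-rearrange (proj₂ root)

  -- for b₁ = ζ and b₂ = ζs with s^q = s - w u⁻¹, the arguments b₁^q b₂ and
  -- b₂^q b₁ of the Frobenius sums in [g(1,b₁,·), g(1,b₂,·)] differ by w
  frobSum-arguments : ∀ {s w} → pow R s q ≈ s - w * u⁻¹ →
                      1# * pow R ζ q * (ζ * s) ≈ 1# * pow R (ζ * s) q * ζ + w
  frobSum-arguments {s} {w} s^q = begin
    1# * pow R ζ q * (ζ * s)
      ≈⟨ solve 5 (λ ζq ζ s w u⁻¹ → con 1ℤ :* ζq :* (ζ :* s) :=
           con 1ℤ :* (ζq :* (s :- w :* u⁻¹)) :* ζ :+ w :+ w :* (ζq :* ζ :* u⁻¹ :- con 1ℤ)) refl _ ζ s w u⁻¹ ⟩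
    1# * (pow R ζ q * (s - w * u⁻¹)) * ζ + w + w * (u * u⁻¹ - 1#)
      ≈⟨ +-cong (+-congʳ (*-congʳ (*-congˡ (sym (trans (pow-distrib-* ζ s q) (*-congˡ s^q))))))
                (*-congˡ (x≈y⇒x-y≈0 u*u⁻¹)) ⟩
    1# * pow R (ζ * s) q * ζ + w + w * 0#
      ≈⟨ trans (+-congˡ (zeroʳ w)) (+-identityʳ _) ⟩
    1# * pow R (ζ * s) q * ζ + w ∎

  -- every d ∈ 𝔽_p is the c-coordinate of the commutator of g(1,ζ,·) and g(1,ζs,·),
  -- where T(w) = d and s^q = s - w u⁻¹
  centralCommutator : ∀ {d} → pow R d p ≈ d → IsCommutator R p e (g 1# 0# d)
  centralCommutator {d} d^p≈d =
    g 1# ζ c₁ , g 1# (ζ * s) c₂ , proj₂ lift₁ , proj₂ lift₂ , (a-part , b-part , c-part)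
    where
    w : Carrier
    w = proj₁ (T-surjective e 1≤e d)
    Tw≈d : T e w ≈ d
    Tw≈d = proj₂ (T-surjective e 1≤e d)
    m : Carrier
    m = w * u⁻¹
    m^q≈-m : pow R m q ≈ - m
    m^q≈-m = trans (pow-distrib-* w u⁻¹ q) (trans (*-cong (T-preimage-fixed Tw≈d d^p≈d) u⁻¹^q)
                   (solve 2 (λ w x → w :* :- x := :- (w :* x)) refl w u⁻¹))
    s : Carrier
    s = proj₁ (twisted-root m^q≈-m)
    s^q : pow R s q ≈ s - m
    s^q = proj₁ (proj₂ (twisted-root m^q≈-m))
    lift₁ : ∃ λ c → InQ R p e (g 1# ζ c)
    lift₁ = unipotent-lift ζ^[q²]
    lift₂ : ∃ λ c → InQ R p e (g 1# (ζ * s) c)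
    lift₂ = unipotent-lift (admissible-scale ζ^[q²] (proj₂ (proj₂ (twisted-root m^q≈-m))))
    c₁ c₂ : Carrier
    c₁ = proj₁ lift₁
    c₂ = proj₁ lift₂
    a-part : 1# * 1# ≈ 1# * (1# * 1#)
    a-part = solve 0 (con 1ℤ :* con 1ℤ := con 1ℤ :* (con 1ℤ :* con 1ℤ)) refl
    b-part : ζ + 1# * (ζ * s) ≈ 0# + 1# * (ζ * s + 1# * ζ)
    b-part = solve 2 (λ b₁ b₂ → b₁ :+ con 1ℤ :* b₂ := con 0ℤ :+ con 1ℤ :* (b₂ :+ con 1ℤ :* b₁)) refl ζ (ζ * s)
    c-part : c₁ + c₂ + T e (1# * pow R ζ q * (ζ * s)) ≈
             d + (c₂ + c₁ + T e (1# * pow R (ζ * s) q * ζ)) + T e (1# * pow R 0# q * (ζ * s + 1# * ζ))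
    c-part = begin
      c₁ + c₂ + T e (1# * pow R ζ q * (ζ * s))
        ≈⟨ +-congˡ (trans (T-cong e (frobSum-arguments s^q)) (trans (T-+ e _ w) (+-congˡ Tw≈d))) ⟩
      c₁ + c₂ + (T e (1# * pow R (ζ * s) q * ζ) + d)
        ≈⟨ solve 4 (λ c₁ c₂ t d → c₁ :+ c₂ :+ (t :+ d) := d :+ (c₂ :+ c₁ :+ t) :+ con 0ℤ) refl c₁ c₂ _ d ⟩
      d + (c₂ + c₁ + T e (1# * pow R (ζ * s) q * ζ)) + 0#
        ≈⟨ +-congˡ (sym (T-left-b≈0 1# _)) ⟩
      d + (c₂ + c₁ + T e (1# * pow R (ζ * s) q * ζ)) + T e (1# * pow R 0# q * (ζ * s + 1# * ζ)) ∎

  -- every g(1,β,c) ∈ Q is the product of the commutators g(1,β,γ(β)) and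
  -- g(1,0,d), where d = c - γ(β) lies in 𝔽_p since both c and γ(β) solve
  -- the Artin–Schreier equation x^p - x = -β^(q+1)
  unipotent∈commutatorSubgroup : ∀ {A β c} → InQ R p e (g A β c) → A ≈ 1# →
                                 InCommutatorSubgroup R p e (g A β c)
  unipotent∈commutatorSubgroup {A} {β} {c} (_ , β-eq , c-eq) A≈1 =
    step (step (unit (refl , refl , refl)) z₁∈Q (torusCommutator β-admissible) z₁≈1·z₁)
         z₂∈Q (centralCommutator d^p≈d) t≈z₁·z₂
    where
    β-admissible : Admissible β
    β-admissible = trans (sym (pow-q² β)) (x+y≈0⇒x≈-y β-eq)
    z₁∈Q : InQ R p e (g 1# β (γ β))
    z₁∈Q = torusCommutator∈Q β-admissible
    B d : Carrier
    B = pow R β (q ℕ.+ 1)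
    d = c - γ β
    d^p≈d : pow R d p ≈ d
    d^p≈d = begin
      pow R (c - γ β) p                 ≈⟨ frobeniusp-sub c (γ β) ⟩
      pow R c p - pow R (γ β) p         ≈⟨ +-cong (artinSchreier-rearrange c-eq)
                                                  (-‿cong (artinSchreier-rearrange (proj₂ (proj₂ z₁∈Q)))) ⟩
      (c - B) - (γ β - B)               ≈⟨ solve 3 (λ c γ B → (c :- B) :- (γ :- B) := c :- γ) refl c (γ β) B ⟩
      c - γ β                           ∎
    z₂∈Q : InQ R p e (g 1# 0# d)
    z₂∈Q = unipotent∈Q admissible-0#
      (trans (+-cong (x≈y⇒x-y≈0 d^p≈d) (pow-0# (ℕP.≤-trans q≥1 (ℕP.m≤m+n q 1)))) (+-identityʳ 0#))
    z₁≈1·z₁ : g 1# β (γ β) ≈Q (identityQ R p e ∙ g 1# β (γ β))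
    z₁≈1·z₁ = sym (*-identityˡ 1#) , sym (trans (+-identityˡ _) (*-identityˡ β)) ,
      sym (trans (+-congˡ (T-left-b≈0 1# β))
                 (solve 1 (λ γ → con 0ℤ :+ γ :+ con 0ℤ := γ) refl (γ β)))
    t≈z₁·z₂ : g A β c ≈Q (g 1# β (γ β) ∙ g 1# 0# d)
    t≈z₁·z₂ = trans A≈1 (sym (*-identityˡ 1#)) , solve 1 (λ β → β := β :+ con 1ℤ :* con 0ℤ) refl β ,
      trans (solve 2 (λ c γ → c := γ :+ (c :- γ) :+ con 0ℤ) refl c (γ β)) (+-congˡ (sym (T-zero e (zeroʳ _))))

lemma7p1 : ∀ {c ℓ : Level} (R : CommutativeRing c ℓ) (p e : ℕ) →
    IsAlgClosureOfFp R p → 1 ≤ e →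
    ∀ (t : Triple R) → InQ R p e t →
      (InCommutatorSubgroup R p e t → InQ₀ R p e t) ×
      (InQ₀ R p e t → InCommutatorSubgroup R p e t)
lemma7p1 R p e (p-prime , p≈0 , isField , algClosed , _) 1≤e t t∈Q =
    (λ t∈[Q,Q] → t∈Q , CommutatorsAreUnipotent.commutatorSubgroup-a≈1 R p e t∈[Q,Q])
  , (λ t∈Q₀ → UnipotentsAreCommutators.unipotent∈commutatorSubgroup
                R p e p-prime p≈0 isField algClosed 1≤e t∈Q (proj₂ t∈Q₀))
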